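{- For every $\Gamma\cup\{\varphi\}\subseteq For(\Sigma)$, if $\Gamma\vdash_{DCila}\varphi$, then $\Gamma\vDash_{DCila}\varphi$.
   Context: **Syntax.** $For(\Sigma)$ is the set of formulas generated from a denumerable set of propositional variables by the signature $\Sigma=\{\to,\neg,\lor,\land,\mathsf{O},\circ\}$ ($\neg,\mathsf{O},\circ$ unary; $\to,\lor,\land$ binary). **The logic $DCila$.** Hilbert calculus whose axiom schemas are those of $CPL^+$, the positive fragment of classical propositional logic in $\to,\land,\lor$ (for instance: $\alpha\to(\beta\to\alpha)$; $(\alpha\to(\beta\to\gamma))\to((\alpha\to\beta)\to(\alpha\to\gamma))$; $\alpha\to(\beta\to(\alpha\land\beta))$; $(\alpha\land\beta)\to\alpha$; $(\alpha\land\beta)\to\beta$; $\alpha\to(\alpha\lor\beta)$; $\beta\to(\alpha\lor\beta)$; $(\alpha\to\gamma)\to((\beta\to\gamma)\to((\alpha\lor\beta)\to\gamma))$; $\alpha\lor(\alpha\to\beta)$), plus (EM) $\alpha\lor\neg\alpha$; (bc) $\circ\alpha\to(\alpha\to(\neg\alpha\to\beta))$; ($\mathsf{O}$-K) $\mathsf{O}(\alpha\to\beta)\to(\mathsf{O}\alpha\to\mathsf{O}\beta)$; ($\mathsf{O}$-E) $\mathsf{O}\bot_\alpha\to\bot_\alpha$, where $\bot_\alpha:=(\alpha\land\neg\alpha)\land\circ\alpha$; (ci) $\neg\circ\alpha\to(\alpha\land\neg\alpha)$; (cl) $\neg(\alpha\land\neg\alpha)\to\circ\alpha$; (cf) $\neg\neg\alpha\to\alpha$;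 and (ca$_\#$) $(\circ\alpha\land\circ\beta)\to\circ(\alpha\#\beta)$ for each $\#\in\{\land,\lor,\to\}$. The rules are Modus Ponens and $\mathsf{O}$-necessitation (from $\varphi$ infer $\mathsf{O}\varphi$). $\vdash_{DCila}\varphi$ means that there is a finite derivation of $\varphi$ from axioms (no premises) using the rules. $\Gamma\vdash_{DCila}\varphi$ means: either $\vdash_{DCila}\varphi$, or there are $\gamma_1,\dots,\gamma_k\in\Gamma$ ($k\ge 1$ finite) with $\vdash_{DCila}(\gamma_1\land\dots\land\gamma_k)\to\varphi$. **Semantics.** Let $A=\{T,t,F\}$ with $T=(1,0)$, $t=(1,1)$, $F=(0,1)$; for $a\in A$ write $a=(a_1,a_2)$. Designated values: $\mathcal{D}=\{T,t\}$. Let $\sqcap,\sqcup,\supset,{\sim}$ be the Boolean meet, join, implication and complement on $\{0,1\}$, and $\bigwedge$ the meet of a non-empty subset. For $a,b\in A$, $\emptyset\neq X\subseteq A$: - $a\,\tilde\land\,b=\{c\in A: c_1=a_1\sqcap b_1\}$; $a\,\tilde\lor\,b=\{c\in A: c_1=a_1\sqcup b_1\}$; $a\,\tilde\to\,b=\{c\in A: c_1=a_1\supset b_1\}$; - $\tilde\neg_1 a=\{c\in A: c_1=a_2\text{ and }c_2\le a_1\}$; $\tilde\circ_2 a=\{({\sim}(a_1\sqcap a_2),\,a_1\sqcap a_2)\}$; - $\tilde{\mathsf{O}}(X)=\{c\in A: c_1=\bigwedge\{x_1:x\in X\}\}$. A swap Kripke model for $DCila$ is a triple $\langle W,R,\{v_w\}_{w\in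 W}\rangle$ where $W\ne\emptyset$, $R\subseteq W^2$ is serial (every $w$ has some $w'$ with $wRw'$), and each $v_w:For(\Sigma)\to A$ satisfies, for all $\alpha,\beta$ and all $\#\in\{\land,\lor,\to\}$: $v_w(\alpha\#\beta)\in v_w(\alpha)\,\tilde\#\,v_w(\beta)$; $v_w(\neg\alpha)\in\tilde\neg_1 v_w(\alpha)$; $v_w(\circ\alpha)\in\tilde\circ_2 v_w(\alpha)$; $v_w(\mathsf{O}\alpha)\in\tilde{\mathsf{O}}(\{v_{w'}(\alpha): wRw'\})$; and, in addition: if $v_w(\alpha)=t$ then $v_w(\alpha\land\neg\alpha)=T$; if $v_w(\alpha),v_w(\beta)\in\{T,F\}$ then $v_w(\alpha\#\beta)\in\{T,F\}$. $\mathcal{M},w\vDash\alpha$ means $v_w(\alpha)\in\mathcal{D}$; $\mathcal{M},w\vDash\Gamma$ means $\mathcal{M},w\vDash\gamma$ for all $\gamma\in\Gamma$. $\Gamma\vDash_{DCila}\alpha$ means: for every swap Kripke model $\mathcal{M}$ for $DCila$ and every world $w$ of it, $\mathcal{M},w\vDash\Gamma$ implies $\mathcal{M},w\vDash\alpha$. -}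

module Defs where

open import Data.Bool.Base using (Bool; true; false; _≤_)
  renaming (_∧_ to _⊓_; _∨_ to _⊔_; not to ∼_)
open import Data.List.NonEmpty using (List⁺; foldr₁)
open import Data.List.NonEmpty.Relation.Unary.All using (All)
open import Data.Nat.Base using (ℕ)
open import Data.Product using (_×_; _,_; proj₁; proj₂; ∃-syntax)
open import Data.Sum.Base using (_⊎_)
open import Level using (Level; suc) renaming (_⊔_ to _⊔ˡ_)
open import Relation.Binary.Core using (Rel)
open import Relation.Binary.PropositionalEquality.Core using (_≡_)
open import Relation.Unary using (Pred; _∈_; ｛_｝; _∪_)

private
  variable
    g x ℓ ℓ′ : Level

infixr 5 _⇒_
infixr 6 _∨_
infixr 7 _∧_
infix  8 ¬_ ∘_ O_
infix  6 _⟨_⟩_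
infix  2 ⊢_ _⊢_ _,_⊨_ _,_⊨*_ _⊨[_,_]_

data Form : Set where
  var         : ℕ → Form
  _⇒_ _∨_ _∧_ : Form → Form → Form
  ¬_ O_ ∘_    : Form → Form

data Connective : Set where
  and or imp : Connective

_⟨_⟩_ : Form → Connective → Form → Form
α ⟨ and ⟩ β = α ∧ β
α ⟨ or  ⟩ β = α ∨ β
α ⟨ imp ⟩ β = α ⇒ β

bot : Form → Form
bot α = (α ∧ ¬ α) ∧ ∘ α

data Axiom : Form → Set where
  ax₁  : ∀ α β → Axiom (α ⇒ (β ⇒ α))
  ax₂  : ∀ α β γ → Axiom ((α ⇒ (β ⇒ γ)) ⇒ ((α ⇒ β) ⇒ (α ⇒ γ)))
  ax₃  : ∀ α β → Axiom (α ⇒ (β ⇒ (α ∧ β)))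
  ax₄  : ∀ α β → Axiom ((α ∧ β) ⇒ α)
  ax₅  : ∀ α β → Axiom ((α ∧ β) ⇒ β)
  ax₆  : ∀ α β → Axiom (α ⇒ (α ∨ β))
  ax₇  : ∀ α β → Axiom (β ⇒ (α ∨ β))
  ax₈  : ∀ α β γ → Axiom ((α ⇒ γ) ⇒ ((β ⇒ γ) ⇒ ((α ∨ β) ⇒ γ)))
  ax₉  : ∀ α β → Axiom (α ∨ (α ⇒ β))
  EM   : ∀ α → Axiom (α ∨ ¬ α)
  bc   : ∀ α β → Axiom (∘ α ⇒ (α ⇒ (¬ α ⇒ β)))
  O-K  : ∀ α β → Axiom (O (α ⇒ β) ⇒ (O α ⇒ O β))
  O-E  : ∀ α → Axiom (O (bot α) ⇒ bot α)
  ci   : ∀ α → Axiom (¬ (∘ α) ⇒ (α ∧ ¬ α))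
  cl   : ∀ α → Axiom (¬ (α ∧ ¬ α) ⇒ ∘ α)
  cf   : ∀ α → Axiom (¬ (¬ α) ⇒ α)
  ca   : ∀ # α β → Axiom ((∘ α ∧ ∘ β) ⇒ ∘ (α ⟨ # ⟩ β))

data ⊢_ : Form → Set where
  axiom : ∀ {φ} → Axiom φ → ⊢ φ
  MP    : ∀ {φ ψ} → ⊢ φ ⇒ ψ → ⊢ φ → ⊢ ψ
  O-nec : ∀ {φ} → ⊢ φ → ⊢ O φ

-- γ₁ ∧ (γ₂ ∧ (… ∧ γₖ)), which is γ₁ itself when k = 1.
⋀ : List⁺ Form → Form
⋀ = foldr₁ _∧_

-- Premises enter only through a finite conjunction, so O-nec is never applied
-- to a formula that depends on Γ.
_⊢_ : Pred Form g → Form → Set g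
Γ ⊢ φ = (⊢ φ) ⊎ (∃[ γs ] All (_∈ Γ) γs × (⊢ ⋀ γs ⇒ φ))

data A : Set where
  T t F : A

pair : A → Bool × Bool
pair T = true  , false
pair t = true  , true
pair F = false , true

_₁ _₂ : A → Bool
a ₁ = proj₁ (pair a)
a ₂ = proj₂ (pair a)

Designated : Pred A _
Designated = ｛ T ｝ ∪ ｛ t ｝

_⊃_ : Bool → Bool → Bool
a ⊃ b = ∼ a ⊔ b

boolOp : Connective → Bool → Bool → Bool
boolOp and = _⊓_
boolOp or  = _⊔_
boolOp imp = _⊃_

binary~ : Connective → A → A → Pred A _
binary~ # a b c = c ₁ ≡ boolOp # (a ₁) (b ₁)

¬~₁ : A → Pred A _
¬~₁ a c = c ₁ ≡ a ₂ × c ₂ ≤ a ₁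

∘~₂ : A → Pred A _
∘~₂ a c = pair c ≡ (∼ (a ₁ ⊓ a ₂) , a ₁ ⊓ a ₂)

-- The meet of an arbitrary set of Booleans is not computable, so it is given
-- as a relation: b is the greatest lower bound of Y.
IsMeet : Pred Bool x → Pred Bool x
IsMeet Y b = (∀ y → y ∈ Y → b ≤ y) × (∀ c → (∀ y → y ∈ Y → c ≤ y) → c ≤ b)

O~ : Pred A x → Pred A x
O~ X c = IsMeet (λ y → ∃[ a ] a ∈ X × y ≡ a ₁) (c ₁)

Classical : Pred A _
Classical = ｛ T ｝ ∪ ｛ F ｝

record SwapModel (ℓ ℓ′ : Level) : Set (suc (ℓ ⊔ˡ ℓ′)) where
  field
    W         : Set ℓ
    inhabited : W
    R         : Rel W ℓ′
    serial    : ∀ w → ∃[ w′ ] R w w′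
    v         : W → Form → A

    v-binary  : ∀ w # α β → v w (α ⟨ # ⟩ β) ∈ binary~ # (v w α) (v w β)
    v-¬       : ∀ w α → v w (¬ α) ∈ ¬~₁ (v w α)
    v-∘       : ∀ w α → v w (∘ α) ∈ ∘~₂ (v w α)
    v-O       : ∀ w α → v w (O α) ∈ O~ (λ a → ∃[ w′ ] R w w′ × a ≡ v w′ α)

    v-cl      : ∀ w α → v w α ≡ t → v w (α ∧ ¬ α) ≡ T
    v-ca      : ∀ w # α β → v w α ∈ Classical → v w β ∈ Classical →
                v w (α ⟨ # ⟩ β) ∈ Classical

open SwapModel using (W; v)

_,_⊨_ : (M : SwapModel ℓ ℓ′) → W M → Form → Set
M , w ⊨ α = v M w α ∈ Designated

_,_⊨*_ : (M : SwapModel ℓ ℓ′) → W M → Pred Form g → Set g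
M , w ⊨* Γ = ∀ γ → γ ∈ Γ → M , w ⊨ γ

-- The levels say in which universes the worlds and the accessibility relation
-- of the models quantified over live.
_⊨[_,_]_ : Pred Form g → (ℓ ℓ′ : Level) → Form → Set (g ⊔ˡ suc (ℓ ⊔ˡ ℓ′))
Γ ⊨[ ℓ , ℓ′ ] φ = (M : SwapModel ℓ ℓ′) (w : W M) → M , w ⊨* Γ → M , w ⊨ φ

{-# OPTIONS --safe #-}
-- Satisfaction at a world depends only on the first coordinate of the value,
-- and that coordinate is Boolean for ∧, ∨, ⇒, so the positive axioms are read
-- off as λ-terms.  The second coordinate matters only for the axioms about ¬
-- and ∘: ∘ α holds exactly when v w α is T or F, which v-cl and v-ca connect to
-- cl and ca.
module Submission where

open import Defs
open import Data.Bool.Base using (true; false; _≤_; b≤b)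
open import Data.Bool.Properties using (≤-reflexive)
open import Data.Empty using (⊥)
open import Data.List.NonEmpty using (_∷_)
open import Data.List.NonEmpty.Relation.Unary.All using (_∷_)
open import Data.List.Relation.Unary.All as All using (All; []; _∷_)
open import Data.Product using (_×_; _,_; proj₁; proj₂; uncurry)
open import Data.Sum.Base using (_⊎_; inj₁; inj₂; [_,_]′)
open import Level using (Level)
open import Relation.Binary.PropositionalEquality
  using (_≡_; refl; sym; trans; cong; subst)
open import Relation.Nullary using (contradiction)
open import Relation.Unary using (Pred; _∈_)

private
  variable
    a b : A

designated⇒₁ : a ∈ Designated → a ₁ ≡ true
designated⇒₁ (inj₁ refl) = refl
designated⇒₁ (inj₂ refl) = refl

₁⇒designated : a ₁ ≡ true → a ∈ Designated
₁⇒designated {T} _ = inj₁ refl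
₁⇒designated {t} _ = inj₂ refl

₁-or-₂ : ∀ a → a ₁ ≡ true ⊎ a ₂ ≡ true
₁-or-₂ T = inj₁ refl
₁-or-₂ t = inj₁ refl
₁-or-₂ F = inj₂ refl

both⇒t : a ₁ ≡ true → a ₂ ≡ true → a ≡ t
both⇒t {t} _ _ = refl

t-or-classical : ∀ a → a ≡ t ⊎ a ∈ Classical
t-or-classical T = inj₂ (inj₁ refl)
t-or-classical t = inj₁ refl
t-or-classical F = inj₂ (inj₂ refl)

t∉Classical : t ∈ Classical → ⊥
t∉Classical (inj₁ ())
t∉Classical (inj₂ ())

∘~₂-₁⇒classical : b ∈ ∘~₂ a → b ₁ ≡ true → a ∈ Classical
∘~₂-₁⇒classical {a = T}     _ _ = inj₁ refl
∘~₂-₁⇒classical {T} {a = t} () _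
∘~₂-₁⇒classical {t} {a = t} () _
∘~₂-₁⇒classical {a = F}     _ _ = inj₂ refl

classical⇒∘~₂-₁ : b ∈ ∘~₂ a → a ∈ Classical → b ₁ ≡ true
classical⇒∘~₂-₁ e (inj₁ refl) = cong proj₁ e
classical⇒∘~₂-₁ e (inj₂ refl) = cong proj₁ e

∘~₂-₂⇒t : b ∈ ∘~₂ a → b ₂ ≡ true → a ≡ t
∘~₂-₂⇒t {a = T} e p = contradiction (trans (sym p) (cong proj₂ e)) λ ()
∘~₂-₂⇒t {a = t} _ _ = refl
∘~₂-₂⇒t {a = F} e p = contradiction (trans (sym p) (cong proj₂ e)) λ ()

true≤⇒≡true : ∀ {x} → true ≤ x → x ≡ true
true≤⇒≡true b≤b = refl

module Soundness {ℓ ℓ′ : Level} (M : SwapModel ℓ ℓ′) where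
  open SwapModel M

  infix 2 _⊩_

  -- A Boolean equation in place of the disjunction `Designated`: the conditions of the model are
  -- equations on first coordinates, so they chain with it by `trans`.
  _⊩_ : W → Form → Set
  w ⊩ α = (v w α) ₁ ≡ true

  private
    variable
      w   : W
      α β : Form

  ⇒-intro : (w ⊩ α → w ⊩ β) → w ⊩ α ⇒ β
  -- Abstracting the first coordinate of `v w α` turns `w ⊩ α` inside the type of `f` into an
  -- equation between Boolean constants, and the right side of the table condition computes.
  ⇒-intro {w} {α} {β} f with (v w α) ₁ | v-binary w imp α β
  ... | true  | e = trans e (f refl)
  ... | false | e = e

  ⇒-elim : w ⊩ α ⇒ β → w ⊩ α → w ⊩ β
  ⇒-elim {w} {α} {β} p q with (v w α) ₁ | v-binary w imp α β
  ⇒-elim p refl | true | e = trans (sym e) p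

  ∧-intro : w ⊩ α → w ⊩ β → w ⊩ α ∧ β
  ∧-intro {w} {α} {β} p q with (v w α) ₁ | v-binary w and α β
  ∧-intro refl q | true | e = trans e q

  ∧-elim : w ⊩ α ∧ β → (w ⊩ α) × (w ⊩ β)
  ∧-elim {w} {α} {β} p with (v w α) ₁ | v-binary w and α β
  ... | true  | e = refl , trans (sym e) p
  ... | false | e = contradiction (trans (sym p) e) λ ()

  ∨-introˡ : w ⊩ α → w ⊩ α ∨ β
  ∨-introˡ {w} {α} {β} p with (v w α) ₁ | v-binary w or α β
  ∨-introˡ refl | true | e = e

  ∨-introʳ : w ⊩ β → w ⊩ α ∨ β
  ∨-introʳ {w} {β} {α} p with (v w α) ₁ | v-binary w or α β
  ... | true  | e = e
  ... | false | e = trans e p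

  ∨-elim : w ⊩ α ∨ β → (w ⊩ α) ⊎ (w ⊩ β)
  ∨-elim {w} {α} {β} p with (v w α) ₁ | v-binary w or α β
  ... | true  | _ = inj₁ refl
  ... | false | e = inj₂ (trans (sym e) p)

  ∨-⇒ : w ⊩ α ∨ (α ⇒ β)
  ∨-⇒ {w} {α} {β} with (v w α) ₁ in eq
  ... | true  = ∨-introˡ eq
  ... | false = ∨-introʳ (⇒-intro λ p → contradiction (trans (sym p) eq) λ ())

  ¬-intro : (v w α) ₂ ≡ true → w ⊩ ¬ α
  ¬-intro = trans (proj₁ (v-¬ _ _))

  ¬-elim : w ⊩ ¬ α → (v w α) ₂ ≡ true
  ¬-elim = trans (sym (proj₁ (v-¬ _ _)))

  -- Uses the bound `c ₂ ≤ a ₁` in `¬~₁`: truth of `¬ ¬ α` is the second coordinate of `v w (¬ α)`,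
  -- which lies below the first coordinate of `v w α`.
  ¬¬-elim : w ⊩ ¬ ¬ α → w ⊩ α
  ¬¬-elim {w} {α} p =
    true≤⇒≡true (subst (_≤ (v w α) ₁) (¬-elim p) (proj₂ (v-¬ w α)))

  ∘-intro : v w α ∈ Classical → w ⊩ ∘ α
  ∘-intro = classical⇒∘~₂-₁ (v-∘ _ _)

  ∘-elim : w ⊩ ∘ α → v w α ∈ Classical
  ∘-elim = ∘~₂-₁⇒classical (v-∘ _ _)

  -- Only the value `t` makes both `α` and `¬ α` true, and `∘ α` excludes it.
  ∘-explosive : w ⊩ ∘ α → w ⊩ α → w ⊩ ¬ α → ⊥
  ∘-explosive c p q =
    t∉Classical (subst (_∈ Classical) (both⇒t p (¬-elim q)) (∘-elim c))

  t⇒contradictory : v w α ≡ t → w ⊩ α ∧ ¬ α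
  t⇒contradictory {w} {α} e = cong _₁ (v-cl w α e)

  bot-elim : w ⊩ bot α → ⊥
  bot-elim p with ∧-elim p
  ... | q , c = uncurry (∘-explosive c) (∧-elim q)

  O-intro : (∀ w′ → R w w′ → w′ ⊩ α) → w ⊩ O α
  O-intro {w} {α} f = true≤⇒≡true
    -- `true` is a lower bound of the values at the successors, hence below their greatest lower
    -- bound.
    (proj₂ (v-O w α) true λ { _ (_ , (w′ , r , refl) , refl) →
      ≤-reflexive (sym (f w′ r)) })

  O-elim : w ⊩ O α → ∀ w′ → R w w′ → w′ ⊩ α
  O-elim {w} {α} p w′ r = true≤⇒≡true
    (subst (_≤ (v w′ α) ₁) p (proj₁ (v-O w α) _ (_ , (w′ , r , refl) , refl)))

  axiom-sound : ∀ {φ} → Axiom φ → ∀ w → w ⊩ φ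
  axiom-sound (ax₁ α β)   w = ⇒-intro λ p → ⇒-intro λ _ → p
  axiom-sound (ax₂ α β γ) w = ⇒-intro λ p → ⇒-intro λ q → ⇒-intro λ r →
    ⇒-elim (⇒-elim p r) (⇒-elim q r)
  axiom-sound (ax₃ α β)   w = ⇒-intro λ p → ⇒-intro λ q → ∧-intro p q
  axiom-sound (ax₄ α β)   w = ⇒-intro λ p → proj₁ (∧-elim p)
  axiom-sound (ax₅ α β)   w = ⇒-intro λ p → proj₂ (∧-elim p)
  axiom-sound (ax₆ α β)   w = ⇒-intro ∨-introˡ
  axiom-sound (ax₇ α β)   w = ⇒-intro ∨-introʳ
  axiom-sound (ax₈ α β γ) w = ⇒-intro λ p → ⇒-intro λ q → ⇒-intro λ r →
    [ ⇒-elim p , ⇒-elim q ]′ (∨-elim r)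
  axiom-sound (ax₉ α β)   w = ∨-⇒
  axiom-sound (EM α)      w =
    [ ∨-introˡ , (λ p → ∨-introʳ (¬-intro p)) ]′ (₁-or-₂ (v w α))
  axiom-sound (bc α β)    w = ⇒-intro λ c → ⇒-intro λ p → ⇒-intro λ q →
    contradiction q (∘-explosive c p)
  axiom-sound (O-K α β)   w = ⇒-intro λ p → ⇒-intro λ q → O-intro λ w′ r →
    ⇒-elim (O-elim p w′ r) (O-elim q w′ r)
  axiom-sound (O-E α)     w = ⇒-intro λ p →
    -- Seriality provides a successor at which `bot α` would have to hold.
    let w′ , r = serial w in contradiction (O-elim p w′ r) bot-elim
  axiom-sound (ci α)      w = ⇒-intro λ p →
    -- The second coordinate of `v w (∘ α)` is the meet of both coordinates of `v w α`, which is
    -- true only at `t`.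
    t⇒contradictory (∘~₂-₂⇒t (v-∘ w α) (¬-elim p))
  axiom-sound (cl α)      w = ⇒-intro λ p →
    -- At the value `t`, `v-cl` gives `α ∧ ¬ α` the value `T`, whose second coordinate is false, so
    -- its negation cannot hold.
    [ (λ e → contradiction
        (trans (sym (¬-elim p)) (cong _₂ (v-cl w α e))) λ ())
    , ∘-intro ]′ (t-or-classical (v w α))
  axiom-sound (cf α)      w = ⇒-intro ¬¬-elim
  axiom-sound (ca # α β)  w = ⇒-intro λ p → let c , d = ∧-elim p in
    ∘-intro (v-ca w # α β (∘-elim c) (∘-elim d))

  -- The induction covers all worlds at once because `O-nec` needs its premise at every successor.
  ⊢-sound : ∀ {φ} → ⊢ φ → ∀ w → w ⊩ φ
  ⊢-sound (axiom a) w = axiom-sound a w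
  ⊢-sound (MP p q)  w = ⇒-elim (⊢-sound p w) (⊢-sound q w)
  ⊢-sound (O-nec p) w = O-intro λ w′ _ → ⊢-sound p w′

  ⋀-intro : ∀ {αs} → w ⊩ α → All (w ⊩_) αs → w ⊩ ⋀ (α ∷ αs)
  ⋀-intro p []       = p
  ⋀-intro p (q ∷ qs) = ∧-intro p (⋀-intro q qs)

theorem5p3 : ∀ {g} (Γ : Pred Form g) (φ : Form) →
    Γ ⊢ φ → (ℓ ℓ′ : Level) → Γ ⊨[ ℓ , ℓ′ ] φ
theorem5p3 Γ φ (inj₁ p) ℓ ℓ′ M w _ = ₁⇒designated (⊢-sound p w)
  where open Soundness M
theorem5p3 Γ φ (inj₂ (_ , γ∈Γ ∷ γs∈Γ , p)) ℓ ℓ′ M w w⊨Γ =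
  -- The derived implication holds at every world, so modus ponens at `w` against the conjoined
  -- premises suffices.
  ₁⇒designated (⇒-elim (⊢-sound p w) (⋀-intro (sat γ∈Γ) (All.map sat γs∈Γ)))
  where
  open Soundness M
  sat : ∀ {γ} → γ ∈ Γ → w ⊩ γ
  sat {γ} γ∈Γ = designated⇒₁ (w⊨Γ γ γ∈Γ)
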